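{- Consider the following three graphs on the vertex set $\{a,b,c,x,y,z\}$: (1) $N(a)=\{c,x,y,z\}$, $N(b)=\{x,y,z\}$, $N(c)=\{a,y\}$, $N(x)=\{a,b,y,z\}$, $N(y)=\{a,b,c,x\}$, $N(z)=\{a,b,x\}$; (2) $N(a)=N(b)=\{c,x,y,z\}$, $N(c)=\{a,b,x,y\}$, $N(x)=\{a,b,c,y\}$, $N(y)=\{a,b,c,x\}$, $N(z)=\{a,b\}$; (3) $N(a)=N(b)=\{c,x,y,z\}$, $N(c)=N(z)=\{a,b,x,y\}$, $N(x)=\{a,b,c,z\}$, $N(y)=\{a,b,c,z\}$. For each of these graphs, the graph obtained by adding a new vertex $w$ and the single edge $xw$ is not a zero-divisor graph.
   Context: For a commutative semigroup $S$ with zero, its zero-divisor graph $\Gamma(S)$ has as vertices the nonzero zero-divisors of $S$, distinct $u,v$ being adjacent iff $uv=0$. A graph is a zero-divisor graph if it is isomorphic to $\Gamma(S)$ for some commutative semigroup $S$ with zero. $N(v)$ denotes the set of neighbors of $v$. (The three six-vertex graphs themselves are known to be zero-divisor graphs.) -}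

module Defs where

open import Level using (Level; _⊔_)
open import Algebra.Bundles using (CommutativeSemigroup)
open import Data.List using (List; []; _∷_)
open import Data.List.Membership.Propositional using (_∈_)
open import Data.Product using (Σ; ∃; _×_)
open import Relation.Nullary using (¬_)
open import Relation.Binary.PropositionalEquality using (_≡_)
open import Function.Bundles using (_⇔_)

record CommSemigroupWithZero (c ℓ : Level) : Set (Level.suc (c ⊔ ℓ)) where
  field
    commutativeSemigroup : CommutativeSemigroup c ℓ
  open CommutativeSemigroup commutativeSemigroup public
  field
    0#   : Carrier
    zero : ∀ s → (s ∙ 0#) ≈ 0#

module _ {c ℓ} (S : CommSemigroupWithZero c ℓ) where
  open CommSemigroupWithZero S

  IsVertex : Carrier → Set (c ⊔ ℓ)
  IsVertex s = ¬ (s ≈ 0#) × Σ Carrier (λ t → ¬ (t ≈ 0#) × (s ∙ t) ≈ 0#)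

  record ΓIso {v e} (V : Set v) (Adj : V → V → Set e) : Set (c ⊔ ℓ ⊔ v ⊔ e) where
    field
      f          : V → Carrier
      f-vertex   : ∀ u → IsVertex (f u)
      f-injective : ∀ u u′ → f u ≈ f u′ → u ≡ u′
      f-surjective : ∀ s → IsVertex s → Σ V (λ u → f u ≈ s)
      f-adj      : ∀ u u′ → ¬ (u ≡ u′) → Adj u u′ ⇔ ((f u ∙ f u′) ≈ 0#)

data V : Set where
  a b c x y z w : V

-- Neighbourhoods of the three graphs (w isolated in these, unused)
N₁ N₂ N₃ : V → List V
N₁ a = c ∷ x ∷ y ∷ z ∷ []
N₁ b = x ∷ y ∷ z ∷ []
N₁ c = a ∷ y ∷ []
N₁ x = a ∷ b ∷ y ∷ z ∷ []
N₁ y = a ∷ b ∷ c ∷ x ∷ []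
N₁ z = a ∷ b ∷ x ∷ []
N₁ w = []
N₂ a = c ∷ x ∷ y ∷ z ∷ []
N₂ b = c ∷ x ∷ y ∷ z ∷ []
N₂ c = a ∷ b ∷ x ∷ y ∷ []
N₂ x = a ∷ b ∷ c ∷ y ∷ []
N₂ y = a ∷ b ∷ c ∷ x ∷ []
N₂ z = a ∷ b ∷ []
N₂ w = []
N₃ a = c ∷ x ∷ y ∷ z ∷ []
N₃ b = c ∷ x ∷ y ∷ z ∷ []
N₃ c = a ∷ b ∷ x ∷ y ∷ []
N₃ x = a ∷ b ∷ c ∷ z ∷ []
N₃ y = a ∷ b ∷ c ∷ z ∷ []
N₃ z = a ∷ b ∷ x ∷ y ∷ []
N₃ w = []

addXW : (V → List V) → V → List V
addXW N x = w ∷ N x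
addXW N w = x ∷ []
addXW N v = N v

Adj : (V → List V) → V → V → Set
Adj N u v = v ∈ N u

{-# OPTIONS --safe #-}
module Submission where

open import Defs
open import Data.Empty using (⊥; ⊥-elim)
open import Data.List using (List; []; _∷_; _++_; filter)
open import Data.List.Membership.Propositional using (_∈_; _∉_)
open import Data.List.Membership.Propositional.Properties using (∈-filter⁺)
import Data.List.Membership.DecPropositional as DecMembership
open import Data.List.Relation.Unary.All as All using (All; []; _∷_; all?)
open import Data.List.Relation.Unary.All.Properties using (++⁺)
open import Data.List.Relation.Unary.Any using (here; there)
open import Data.Nat using (ℕ)
import Data.Nat.Properties as ℕ
open import Data.Product using (∃; _×_; _,_)
open import Data.Sum using (_⊎_; inj₁; inj₂; [_,_]′)
open import Function using (_∘_)
open import Function.Bundles using (module Equivalence)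
open import Relation.Binary.Definitions using (DecidableEquality)
open import Relation.Binary.PropositionalEquality as ≡ using (_≡_; _≢_)
open import Relation.Nullary using (¬_; Dec)
open import Relation.Nullary.Decidable
  using (True; toWitness; map′; ¬?; _×-dec_)
import Algebra.Properties.CommutativeSemigroup as SemigroupProperties

-- A nonzero product is again a zero-divisor, hence a vertex, and it is
-- annihilated by every neighbour of either factor; only a few vertices t have
-- a neighbourhood (up to t itself) allowing this.  The surviving values are
-- eliminated by comparing (uv)v′ with (uv′)v, one of which is zero and the
-- other nonzero.  The graph does not tell whether a square u² vanishes, but
-- u²v = u(uv) is known once uv is, and this locates w² in graphs (1) and (3)
-- and c² in graph (1).

index : V → ℕ
index a = 0
index b = 1
index c = 2
index x = 3
index y = 4
index z = 5
index w = 6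

vertex : ℕ → V
vertex 0 = a
vertex 1 = b
vertex 2 = c
vertex 3 = x
vertex 4 = y
vertex 5 = z
vertex _ = w

vertex-index : ∀ v → vertex (index v) ≡ v
vertex-index a = ≡.refl
vertex-index b = ≡.refl
vertex-index c = ≡.refl
vertex-index x = ≡.refl
vertex-index y = ≡.refl
vertex-index z = ≡.refl
vertex-index w = ≡.refl

index-injective : ∀ {u v} → index u ≡ index v → u ≡ v
index-injective {u} {v} eq =
  ≡.trans (≡.sym (vertex-index u)) (≡.trans (≡.cong vertex eq) (vertex-index v))

_≟_ : DecidableEquality V
u ≟ v = map′ index-injective (≡.cong index) (index u ℕ.≟ index v)

open DecMembership _≟_ using (_∈?_)

vertices : List V
vertices = a ∷ b ∷ c ∷ x ∷ y ∷ z ∷ w ∷ []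

∈-vertices : ∀ v → v ∈ vertices
∈-vertices a = here ≡.refl
∈-vertices b = there (here ≡.refl)
∈-vertices c = there (there (here ≡.refl))
∈-vertices x = there (there (there (here ≡.refl)))
∈-vertices y = there (there (there (there (here ≡.refl))))
∈-vertices z = there (there (there (there (there (here ≡.refl)))))
∈-vertices w = there (there (there (there (there (there (here ≡.refl))))))

module Graph (N : V → List V) where

  Edge NonEdge : V → V → Set
  Edge    u v = u ≢ v × v ∈ N u
  NonEdge u v = u ≢ v × v ∉ N u

  edge? : ∀ u v → Dec (Edge u v)
  edge? u v = ¬? (u ≟ v) ×-dec (v ∈? N u)

  nonEdge? : ∀ u v → Dec (NonEdge u v)
  nonEdge? u v = ¬? (u ≟ v) ×-dec ¬? (v ∈? N u)

  -- Phrased negatively because the graph says nothing about the square of t.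
  Compatible : List V → List V → V → Set
  Compatible zs ns t = All (¬_ ∘ NonEdge t) zs × All (¬_ ∘ Edge t) ns

  compatible? : ∀ zs ns t → Dec (Compatible zs ns t)
  compatible? zs ns t =
    all? (λ u → ¬? (nonEdge? t u)) zs ×-dec all? (λ u → ¬? (edge? t u)) ns

  -- This list evaluates on closed arguments, so matching on membership in it leaves one case per
  -- surviving vertex, in the order of `vertices`.
  candidates : List V → List V → List V
  candidates zs ns = filter (compatible? zs ns) vertices

module Representation {k ℓ} (S : CommSemigroupWithZero k ℓ)
  (N : V → List V) (iso : ΓIso S V (Adj N)) where

  open CommSemigroupWithZero S public
  open ΓIso iso public
  open Graph N public
  open SemigroupProperties commutativeSemigroup public using (xy∙z≈xz∙y)

  _≉0 : Carrier → Set ℓ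
  p ≉0 = ¬ (p ≈ 0#)

  edge⇒≈0 : ∀ {u v} → Edge u v → f u ∙ f v ≈ 0#
  edge⇒≈0 {u} {v} (u≢v , v∈) = Equivalence.to (f-adj u v u≢v) v∈

  nonEdge⇒≉0 : ∀ {u v} → NonEdge u v → (f u ∙ f v) ≉0
  nonEdge⇒≉0 {u} {v} (u≢v , v∉) = v∉ ∘ Equivalence.from (f-adj u v u≢v)

  edge : ∀ u v {_ : True (edge? u v)} → f u ∙ f v ≈ 0#
  edge u v {e} = edge⇒≈0 (toWitness e)

  nonEdge : ∀ u v {_ : True (nonEdge? u v)} → (f u ∙ f v) ≉0
  nonEdge u v {n} = nonEdge⇒≉0 (toWitness n)

  ∙-annihilatedʳ : ∀ {p q r} → q ∙ r ≈ 0# → (p ∙ q) ∙ r ≈ 0#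
  ∙-annihilatedʳ {p} qr≈0 = trans (assoc _ _ _) (trans (∙-congˡ qr≈0) (zero p))

  ∙-annihilatedˡ : ∀ {p q r} → p ∙ r ≈ 0# → (p ∙ q) ∙ r ≈ 0#
  ∙-annihilatedˡ pr≈0 = trans (∙-congʳ (comm _ _)) (∙-annihilatedʳ pr≈0)

  ∙-≉0ˡ : ∀ {p q} → (p ∙ q) ≉0 → p ≉0
  ∙-≉0ˡ {q = q} pq≉0 p≈0 = pq≉0 (trans (∙-congʳ p≈0) (trans (comm _ _) (zero q)))

  ∙-isVertex : ∀ {p q} → IsVertex S p → (p ∙ q) ≉0 → IsVertex S (p ∙ q)
  ∙-isVertex (_ , r , r≉0 , pr≈0) pq≉0 = pq≉0 , r , r≉0 , ∙-annihilatedˡ pr≈0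

  Located : List V → List V → Carrier → Set ℓ
  Located zs ns p = ∃ λ t → t ∈ candidates zs ns × f t ≈ p

  locate : ∀ {p zs ns} → IsVertex S p →
    All (λ u → p ∙ f u ≈ 0#) zs → All (λ u → (p ∙ f u) ≉0) ns → Located zs ns p
  locate {p} {zs} {ns} p-vertex zs≈0 ns≉0 with f-surjective p p-vertex
  ... | t , ft≈p =
    t , ∈-filter⁺ (compatible? zs ns) (∈-vertices t) (compatible-zs , compatible-ns) , ft≈p
    where
    compatible-zs : All (¬_ ∘ NonEdge t) zs
    compatible-zs = All.map (λ pu≈0 n → nonEdge⇒≉0 n (trans (∙-congʳ ft≈p) pu≈0)) zs≈0

    compatible-ns : All (¬_ ∘ Edge t) ns
    compatible-ns = All.map (λ pu≉0 e → pu≉0 (trans (∙-congʳ (sym ft≈p)) (edge⇒≈0 e))) ns≉0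

  -- The `all?` arguments, settled by evaluation, certify that neither vertex occurs in its own
  -- list, since `Edge` asks for distinct endpoints.
  locate-product : ∀ u v {_ : True (nonEdge? u v)}
    {_ : True (all? (edge? u) (N u))} {_ : True (all? (edge? v) (N v))} →
    Located (N u ++ N v) [] (f u ∙ f v)
  locate-product u v {n} {eu} {ev} =
    locate (∙-isVertex (f-vertex u) (nonEdge u v {n}))
      (++⁺ (All.map (∙-annihilatedˡ ∘ edge⇒≈0) (toWitness eu))
           (All.map (∙-annihilatedʳ ∘ edge⇒≈0) (toWitness ev)))
      []

  -- A square may be zero, so the list of non-annihilators carries a head `n₀`: from `u²n₀ ≠ 0`
  -- follows `u² ≠ 0`, which makes the square a vertex.
  locate-square : ∀ u n₀ {zs ns} → All (λ v → (f u ∙ f u) ∙ f v ≈ 0#) zs →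
    All (λ v → ((f u ∙ f u) ∙ f v) ≉0) (n₀ ∷ ns) → Located zs (n₀ ∷ ns) (f u ∙ f u)
  locate-square u n₀ zs≈0 ns≉0@(n₀≉0 ∷ _) =
    locate (∙-isVertex (f-vertex u) (∙-≉0ˡ n₀≉0)) zs≈0 ns≉0

  square-≈0 : ∀ {u v t} → f t ≈ f u ∙ f v → {_ : True (edge? u t)} →
    (f u ∙ f u) ∙ f v ≈ 0#
  square-≈0 ft≈uv {e} =
    trans (assoc _ _ _) (trans (∙-congˡ (sym ft≈uv)) (edge⇒≈0 (toWitness e)))

  square-≉0 : ∀ {u v t} → f t ≈ f u ∙ f v → {_ : True (nonEdge? u t)} →
    ((f u ∙ f u) ∙ f v) ≉0
  square-≉0 ft≈uv {n} uuv≈0 =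
    nonEdge⇒≉0 (toWitness n) (trans (∙-congˡ ft≈uv) (trans (sym (assoc _ _ _)) uuv≈0))

  product-≈0 : ∀ {u v t r} → f t ≈ f u ∙ f v → {_ : True (edge? t r)} →
    (f u ∙ f v) ∙ f r ≈ 0#
  product-≈0 ft≈uv {e} = trans (∙-congʳ (sym ft≈uv)) (edge⇒≈0 (toWitness e))

  product-≉0 : ∀ {u v t r} → f t ≈ f u ∙ f v → {_ : True (nonEdge? t r)} →
    ((f u ∙ f v) ∙ f r) ≉0
  product-≉0 ft≈uv {n} uvr≈0 = nonEdge⇒≉0 (toWitness n) (trans (∙-congʳ ft≈uv) uvr≈0)

  -- Taking `v` or `v′` equal to `u` lets the squares `w²` and `c²` enter the comparison.
  clash : ∀ {u v v′ t t′} → f t ≈ f u ∙ f v → f t′ ≈ f u ∙ f v′ →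
    {_ : True (edge? t v′)} {_ : True (nonEdge? t′ v)} → ⊥
  clash ft≈uv ft′≈uv′ {e} {n} =
    product-≉0 ft′≈uv′ {n} (trans (xy∙z≈xz∙y _ _ _) (product-≈0 ft≈uv {e}))

module _ {k ℓ} (S : CommSemigroupWithZero k ℓ) where

  -- The conflict lies in multiplication by `c`: `cw` is `a` or `y`, while `c² = x` forces `cb = a`
  -- and `cz = y`, and each value of `cw` clashes with one of these.
  graph₁-not-zeroDivisor : ¬ ΓIso S V (Adj (addXW N₁))
  graph₁-not-zeroDivisor iso = contradiction
    where
    open Representation S (addXW N₁) iso

    wa≈a : f a ≈ f w ∙ f a
    wa≈a with locate-product w a
    ... | _ , here ≡.refl , eq = eq

    wy≈y : f y ≈ f w ∙ f y
    wy≈y with locate-product w y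
    ... | _ , here ≡.refl , eq = eq

    cx≈x : f x ≈ f c ∙ f x
    cx≈x with locate-product c x
    ... | _ , here ≡.refl , eq = eq

    ww≈w : f w ≈ f w ∙ f w
    -- Annihilation by `x` leaves `x` and its neighbours; of these only `w` is adjacent to neither
    -- `a` nor `y`.
    ww≈w with locate-square w a {x ∷ []} {y ∷ []}
                (∙-annihilatedˡ (edge w x) ∷ [])
                (square-≉0 wa≈a ∷ square-≉0 wy≈y ∷ [])
    ... | _ , here ≡.refl , eq = eq

    cw∈ : f a ≈ f c ∙ f w ⊎ f y ≈ f c ∙ f w
    cw∈ with locate-product c w
    ... | _ , here ≡.refl , eq = inj₁ eq
    -- If `cw = x`, then `(wc)w = xw = 0`, yet `(ww)c = wc ≠ 0`.
    ... | _ , there (here ≡.refl) , eq = ⊥-elim (clash (trans eq (comm _ _)) ww≈w)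
    ... | _ , there (there (here ≡.refl)) , eq = inj₂ eq

    ccw≈0 : (f c ∙ f c) ∙ f w ≈ 0#
    -- Both possible values of `cw` are neighbours of `c`.
    ccw≈0 = [ (λ eq → square-≈0 eq) , (λ eq → square-≈0 eq) ]′ cw∈

    cc≈x : f x ≈ f c ∙ f c
    -- Annihilating `w` leaves only `x` and `w`; annihilating `a` rules out `w`.
    cc≈x with locate-square c x {w ∷ a ∷ []} {[]}
                (ccw≈0 ∷ ∙-annihilatedˡ (edge c a) ∷ []) (square-≉0 cx≈x ∷ [])
    ... | _ , here ≡.refl , eq = eq

    cb≈a : f a ≈ f c ∙ f b
    cb≈a with locate-product c b
    ... | _ , here ≡.refl , eq = eq
    -- If `cb = x`, then `(cb)c = xc ≠ 0`, yet `(cc)b = xb = 0`; `cz = x` fails in the same way.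
    ... | _ , there (here ≡.refl) , eq = ⊥-elim (clash cc≈x eq)

    cz≈y : f y ≈ f c ∙ f z
    cz≈y with locate-product c z
    ... | _ , here ≡.refl , eq = ⊥-elim (clash cc≈x eq)
    ... | _ , there (here ≡.refl) , eq = eq

    contradiction : ⊥
    contradiction with cw∈
    -- `(cw)z = az = 0` against `(cz)w = yw ≠ 0`; in the other case `(cw)b = yb = 0` against
    -- `(cb)w = aw ≠ 0`.
    ... | inj₁ cw≈a = clash cw≈a cz≈y
    ... | inj₂ cw≈y = clash cw≈y cb≈a

  -- The products `wc`, `wy` and `wz` all lie in the triangle `c`, `x`, `y`, no vertex of which is
  -- adjacent to `z`.
  graph₂-not-zeroDivisor : ¬ ΓIso S V (Adj (addXW N₂))
  graph₂-not-zeroDivisor iso = contradiction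
    where
    open Representation S (addXW N₂) iso

    wcz≉0 : ((f w ∙ f c) ∙ f z) ≉0
    wcz≉0 with locate-product w c
    ... | _ , here ≡.refl , wc≈c = product-≉0 wc≈c
    ... | _ , there (here ≡.refl) , wc≈x = product-≉0 wc≈x
    ... | _ , there (there (here ≡.refl)) , wc≈y = product-≉0 wc≈y

    wyz≉0 : ((f w ∙ f y) ∙ f z) ≉0
    wyz≉0 with locate-product w y
    ... | _ , here ≡.refl , wy≈c = product-≉0 wy≈c
    ... | _ , there (here ≡.refl) , wy≈x = product-≉0 wy≈x
    ... | _ , there (there (here ≡.refl)) , wy≈y = product-≉0 wy≈y

    contradiction : ⊥
    contradiction with locate-product w z
    -- When `wz = c`, the factor `y` is taken because `c²` is unknown; the other two values are
    -- annihilated by `c`.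
    ... | _ , here ≡.refl , wz≈c = wyz≉0 (trans (xy∙z≈xz∙y _ _ _) (product-≈0 wz≈c))
    ... | _ , there (here ≡.refl) , wz≈x = wcz≉0 (trans (xy∙z≈xz∙y _ _ _) (product-≈0 wz≈x))
    ... | _ , there (there (here ≡.refl)) , wz≈y =
      wcz≉0 (trans (xy∙z≈xz∙y _ _ _) (product-≈0 wz≈y))

  -- There is no room for `w²`: annihilating `y`, it would be `y` or a neighbour of `y`, but each of
  -- these is adjacent to `a` or `c`, neither of which annihilates `w²`.
  graph₃-not-zeroDivisor : ¬ ΓIso S V (Adj (addXW N₃))
  graph₃-not-zeroDivisor iso = contradiction
    where
    open Representation S (addXW N₃) iso

    wwy≈0 : (f w ∙ f w) ∙ f y ≈ 0#
    wwy≈0 with locate-product w y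
    -- The value `y` is excluded because `x` annihilates `wy` but not `y`.
    ... | _ , here ≡.refl , wy≈x = square-≈0 wy≈x

    wwa≉0 : ((f w ∙ f w) ∙ f a) ≉0
    wwa≉0 with locate-product w a
    ... | _ , here ≡.refl , wa≈a = square-≉0 wa≈a
    ... | _ , there (here ≡.refl) , wa≈b = square-≉0 wa≈b

    wwc≉0 : ((f w ∙ f w) ∙ f c) ≉0
    wwc≉0 with locate-product w c
    ... | _ , here ≡.refl , wc≈c = square-≉0 wc≈c
    ... | _ , there (here ≡.refl) , wc≈z = square-≉0 wc≈z

    contradiction : ⊥
    contradiction with locate-square w a {y ∷ []} {c ∷ []} (wwy≈0 ∷ []) (wwa≉0 ∷ wwc≉0 ∷ [])
    ... | _ , () , _

theorem5p1 : ∀ {c ℓ} (S : CommSemigroupWithZero c ℓ) →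
    ¬ ΓIso S V (Adj (addXW N₁)) × ¬ ΓIso S V (Adj (addXW N₂)) × ¬ ΓIso S V (Adj (addXW N₃))
theorem5p1 S =
  graph₁-not-zeroDivisor S , graph₂-not-zeroDivisor S , graph₃-not-zeroDivisor S
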